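{- Let $D=(V,F)$ be a permutation digraph with underlying undirected graph $G$. Let $P$ be a prime node of the modular decomposition tree of $G$, with set of children $V^P=\{X_1,X_2,\dots,X_p\}$. Let $Q(P)$, $Q^c(P)$ denote the corresponding quotient graphs of $G$, $G^c$ respectively. Let $F^P,-F^P$ denote the (only) two transitive orientations on $Q(P)$, and let $F_1^P,-F_1^P$ denote the two transitive orientations on $Q^c(P)$. Assume that there exists a bijection $f^P:V^P\to V^P$ such that: \begin{itemize} \item $f^P:(V^P,F^P)\to(V^P,F^P)$ and $f^P:(V^P,F_1^P)\to(V^P,-F_1^P)$ are both digraph isomorphisms, and \item for all $1\le i\le p$, $X_i$ and $f^P(X_i)$ induce isomorphic subgraphs of $D$. \end{itemize} Let $g_i:D|X_i\to D|f^P(X_i)$ be a digraph isomorphism. Define $f:V\to V$ by \[ f(v)=\begin{cases} g_i(v), & \text{if } v\in X_i\text{ for some }1\le i\le p,\\ v, & \text{otherwise.}\end{cases} \] For any transitive orientation $F_1$ on $G^c$, define another orientation $F_2$ by \[ (f(v),f(w))\in F_2\iff (v,w)\in F_1. \] Then $F_2$ is also a transitive orientation on $G^c$. Moreover, $F\cup F_1$ and $F\cup F_2$ induce the same permutation.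
   Context: Inversion set: for $\pi\in S_n$, $E(\pi)=\{(i,j):1\le i<j\le n,\ \pi^{ -1}(i)>\pi^{ -1}(j)\}$; $D(\pi)$ is the digraph with vertex set $\{1,\dots,n\}$ and arc set $E(\pi)$. A permutation digraph is a digraph isomorphic to $D(\pi)$ for some $n$ and some $\pi\in S_n$. $D|X$ denotes the subdigraph induced by $X\subseteq V$. $G^c$ is the complement of $G$. An orientation of a graph assigns exactly one direction to each edge; it is a transitive orientation $F$ if $(u,v),(v,w)\in F$ implies $(u,w)\in F$. $-F$ is obtained by reversing all arcs of $F$. Induced permutation: if $|V|=n$ and $F,F_1$ are transitive orientations of $G$ and $G^c$ respectively, then $(V,F\cup F_1)$ is a transitively oriented complete graph, so there is a unique bijection $L:V\to\{1,\dots,n\}$ with $L(v)<L(w)\iff (v,w)\in F\cup F_1$; there is a unique $\pi\in S_n$ with $E(\pi)=\{(L(v),L(w)):(v,w)\in F\}$, called the permutation induced by $F\cup F_1$. Modular decomposition: a module of $G=(V,E)$ is a set $M\subseteq V$ such that each vertex outside $M$ is adjacent to all or to none of the vertices of $M$. Two modules overlap if $M\cap N$, $M\setminus N$, $N\setminus M$ are all non-empty; a module is strong if it overlaps no other module. $G$ and $G^c$ have the same (strong) modules. The modular decomposition tree of $G$ has the (non-empty) strong modules of $G$ as nodes and $V$ as root; the children of a node $M$ with $|M|>1$ are: the connected components of $G|M$ if $G|M$ is disconnected (degenerate $0$-node); the connected components of $G^c|M$ if $G|M$ is connected and $G^c|M$ is disconnected (degenerate $1$-node); the maximal proper submodules of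 $M$ if both $G|M$ and $G^c|M$ are connected ($M$ is then a prime node). The quotient graph $Q(M)$ of $G$ has the children of $M$ as vertices, with distinct children $X,Y$ adjacent iff $xy\in E$ for some (equivalently all) $x\in X$, $y\in Y$; $Q^c(M)$ is the analogous quotient graph for $G^c$. (It is a known result of Gallai that, for a prime node $P$, if $Q(P)$ is transitively orientable then it has exactly one transitive orientation together with its reverse; likewise for $Q^c(P)$.) -}

module Defs where

open import Data.Nat.Base as ℕ using (ℕ)
open import Data.Fin.Base using (Fin; _<_)
open import Data.Fin.Properties using (any?)
open import Data.Fin.Permutation using (Permutation′; _⟨$⟩ˡ_)
open import Data.Fin.Subset
  using (Subset; _∈_; _∉_; _⊆_; _⊂_; _∩_; _─_; ∣_∣; Nonempty)
open import Data.Fin.Subset.Properties using (_∈?_)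
open import Data.Product.Base using (_×_; _,_; proj₁; ∃; ∃₂)
open import Data.Sum.Base using (_⊎_)
open import Function.Base using (_on_)
open import Function.Bundles using (_⇔_)
open import Function.Definitions using (Injective)
open import Level using (0ℓ)
open import Relation.Binary.Construct.Closure.ReflexiveTransitive using (Star)
open import Relation.Binary.Construct.Union using (_∪_)
open import Relation.Binary.Core using (Rel; _⇒_)
open import Relation.Binary.Definitions using (Asymmetric; Transitive)
open import Relation.Binary.Morphism.Structures using (IsOrderIsomorphism)
open import Relation.Binary.PropositionalEquality using (_≡_; _≢_)
open import Relation.Nullary using (¬_; yes; no)

private
  variable
    A B : Set
    n p : ℕ

-- Graphs and digraphs on A are adjacency relations Rel A 0ℓ.

Complement : Rel A 0ℓ → Rel A 0ℓ
Complement G v w = v ≢ w × ¬ G v w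

Connected : Rel A 0ℓ → Set
Connected G = ∀ v w → Star G v w

-- Despite its name, IsOrderIsomorphism asks nothing of the relations R and S:
-- f is a bijection that preserves and reflects arcs.
IsDigraphIso : Rel A 0ℓ → Rel B 0ℓ → (A → B) → Set
IsDigraphIso R S f = IsOrderIsomorphism _≡_ _≡_ R S f

Vertices : Subset n → Set
Vertices X = ∃ (_∈ X)

infix 8 _∣ᵢ_

_∣ᵢ_ : Rel (Fin n) 0ℓ → (X : Subset n) → Rel (Vertices X) 0ℓ
R ∣ᵢ X = R on proj₁

record IsTransitiveOrientation (G F : Rel A 0ℓ) : Set where
  field
    arcs⇒edges : F ⇒ G
    directed   : ∀ {v w} → G v w → F v w ⊎ F w v
    asym       : Asymmetric F
    trans      : Transitive F

InversionSet : Permutation′ n → Rel (Fin n) 0ℓ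
InversionSet π i j = i < j × (π ⟨$⟩ˡ j) < (π ⟨$⟩ˡ i)

IsPermutationDigraph : Rel (Fin n) 0ℓ → Set
IsPermutationDigraph {n} F =
  ∃ λ m → ∃ λ (π : Permutation′ m) → ∃ λ (φ : Fin n → Fin m) →
    IsDigraphIso F (InversionSet π) φ

-- π is the permutation induced by F ∪ F₁, with L the associated labelling.
Induces : (F F₁ : Rel (Fin n) 0ℓ) → Permutation′ n → Set
Induces {n} F F₁ π = ∃ λ (L : Fin n → Fin n) →
  IsDigraphIso (F ∪ F₁) _<_ L ×
  (∀ i j → InversionSet π i j ⇔ ∃₂ λ v w → F v w × L v ≡ i × L w ≡ j)

module _ (G : Rel (Fin n) 0ℓ) where

  IsModule : Subset n → Set
  IsModule M = ∀ {v} → v ∉ M →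
    (∀ {x} → x ∈ M → G v x) ⊎ (∀ {x} → x ∈ M → ¬ G v x)

  Overlap : Subset n → Subset n → Set
  Overlap M N = Nonempty (M ∩ N) × Nonempty (M ─ N) × Nonempty (N ─ M)

  IsStrongModule : Subset n → Set
  IsStrongModule M = IsModule M × (∀ N → IsModule N → ¬ Overlap M N)

  record IsPrimeNode (P : Subset n) : Set where
    field
      strong      : IsStrongModule P
      nontrivial  : 1 ℕ.< ∣ P ∣
      connected   : Connected (G ∣ᵢ P)
      coconnected : Connected (Complement G ∣ᵢ P)

  record IsMaximalProperSubmodule (P X : Subset n) : Set where
    field
      isModule : IsModule X
      proper   : X ⊂ P
      maximal  : ∀ Y → IsModule Y → Y ⊂ P → X ⊆ Y → Y ≡ X

  -- X lists, without repetition, exactly the children of the prime node P;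
  -- a child X i is henceforth represented by its index i.
  record EnumeratesChildren (P : Subset n) (X : Fin p → Subset n) : Set where
    field
      child    : ∀ i → IsMaximalProperSubmodule P (X i)
      complete : ∀ Y → IsMaximalProperSubmodule P Y → ∃ λ i → X i ≡ Y
      distinct : Injective _≡_ _≡_ X

  Quotient : (Fin p → Subset n) → Rel (Fin p) 0ℓ
  Quotient X i j = i ≢ j × ∃₂ λ x y → x ∈ X i × y ∈ X j × G x y

-- The children of a prime node are pairwise disjoint, so it does not matter
-- which i with v ∈ X i is found by any?.
glue : (X : Fin p → Subset n) (fᴾ : Fin p → Fin p) →
       (∀ i → Vertices (X i) → Vertices (X (fᴾ i))) → Fin n → Fin n
glue X fᴾ g v with any? (λ i → v ∈? X i)
... | yes (i , v∈Xi) = proj₁ (g i (v , v∈Xi))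
... | no  _          = v

{-# OPTIONS --safe #-}
module Submission where

-- f is an automorphism of D. For arcs inside a child this is the hypothesis on g i. For arcs
-- between P and a vertex w outside, all arcs between P and w have the same direction, because
-- P is connected in the complement. For arcs between different children it follows from
-- Gallai's theorem: if a class of edges forcing each other's direction contains an edge
-- between two children, the set of its end points is a module, hence all of P; by the
-- triangle lemma two distinct classes cannot both span P. So on arcs between children F
-- agrees with Fᴾ everywhere or with -Fᴾ everywhere, and fᴾ preserves both. Then F ∪ F₂ is
-- the image of F ∪ F₁ under f, and the two induce the same permutation.
-- Only negated or decidable statements are derived from the (undecided) forcing relation,
-- so that classical reasoning about it is available.

open import Defs
open import Data.Nat.Base as ℕ using (ℕ; suc)
import Data.Nat.Properties as ℕ
open import Data.Fin.Base using (Fin; _<_; fromℕ<; punchOut)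
open import Data.Fin.Properties
  using (_≟_; _<?_; <-irrefl; <-asym; <-trans; any?; sequence; toℕ-fromℕ<;
         punchOut-injective; injective⇒≤)
open import Data.Fin.Permutation using (Permutation′; permutation; _⟨$⟩ˡ_)
open import Data.Fin.Subset
  using (Subset; _∈_; _∉_; _⊆_; _⊈_; _⊂_; _⊃_; _∪_; ∣_∣; ⁅_⁆)
open import Data.Fin.Subset.Induction using (⊃-wellFounded; Acc; acc)
open import Data.Fin.Subset.Properties
  using (_∈?_; _⊆?_; ⊆-antisym; ∈⊤; ∣⊤∣≡n; ∣⁅x⁆∣≡1; x∈⁅x⁆; x∈⁅y⁆⇒x≡y;
         p⊆p∪q; q⊆p∪q; x∈p∪q⁻; p⊆q⇒∣p∣≤∣q∣; p⊂q⇒∣p∣<∣q∣)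
open import Data.Product.Base using (_×_; _,_; proj₁; proj₂; ∃; ∃₂)
open import Data.Sum.Base using (_⊎_; inj₁; inj₂; [_,_]′; swap)
open import Data.Vec.Base using (tabulate)
open import Data.Vec.Properties using (lookup∘tabulate; []=⇒lookup; lookup⇒[]=)
open import Data.Vec.Properties.WithK using ([]=-irrelevant)
open import Effect.Monad using (RawMonad)
open import Function.Base using (flip; _∘_; id)
open import Function.Bundles using (_⇔_; mk⇔; Equivalence)
open import Function.Construct.Symmetry using (⇔-sym)
open import Function.Consequences.Propositional using (strictlySurjective⇒surjective)
open import Function.Definitions using (Injective; StrictlySurjective)
open import Level using (0ℓ)
open import Relation.Binary.Construct.Closure.ReflexiveTransitive using (Star; fold)
open import Relation.Binary.Construct.Closure.Symmetric using (SymClosure; fwd; bwd; symmetric)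
import Relation.Binary.Construct.Union as Union
open import Relation.Binary.Core using (Rel; _=[_]⇒_)
open import Relation.Binary.Definitions using (Asymmetric; Decidable; Symmetric; Transitive)
open import Relation.Binary.Morphism.Structures using (module IsOrderIsomorphism)
open import Relation.Binary.PropositionalEquality
  using (_≡_; _≢_; refl; sym; trans; cong; subst; subst₂; ≢-sym)
open import Relation.Nullary using (¬_; Dec; yes; no; does; contradiction)
open import Relation.Nullary.Decidable
  using (_×-dec_; ¬?; map′; dec-true; decidable-stable; ¬¬-excluded-middle)
open import Relation.Nullary.Negation using (¬¬-Monad)
import Relation.Unary as U

private
  variable
    A B : Set
    n p : ℕ

-- Finite sets and subsets

-- Pigeonhole: if `y` is missed, punching it out of the codomain leaves an injection into a smaller
-- set.
injective⇒strictlySurjective : {f : Fin n → Fin n} →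
  Injective _≡_ _≡_ f → StrictlySurjective _≡_ f
injective⇒strictlySurjective {suc n} {f} inj y with any? (λ x → f x ≟ y)
... | yes hit  = hit
... | no  miss = contradiction (injective⇒≤ avoid-injective) ℕ.1+n≰n
  where
  y≢f : ∀ x → y ≢ f x
  y≢f x y≡fx = miss (x , sym y≡fx)

  avoid : Fin (suc n) → Fin n
  avoid x = punchOut (y≢f x)

  avoid-injective : Injective _≡_ _≡_ avoid
  avoid-injective {x} {x′} eq = inj (punchOut-injective (y≢f x) (y≢f x′) eq)

module Comprehension {Q : Fin n → Set} (Q? : U.Decidable Q) where

  subset : Subset n
  subset = tabulate (does ∘ Q?)

  ∈-subset⁺ : ∀ {x} → Q x → x ∈ subset
  ∈-subset⁺ {x} q =
    lookup⇒[]= x subset (trans (lookup∘tabulate _ x) (dec-true (Q? x) q))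

  ∈-subset⁻ : ∀ {x} → x ∈ subset → Q x
  ∈-subset⁻ {x} x∈ with Q? x | trans (sym (lookup∘tabulate (does ∘ Q?) x)) ([]=⇒lookup x∈)
  ... | yes q | _  = q
  ... | no  _ | ()

⊈⇒∃ : {M N : Subset n} → M ⊈ N → ∃ λ x → x ∈ M × x ∉ N
⊈⇒∃ {M = M} {N} M⊈N with any? (λ x → (x ∈? M) ×-dec ¬? (x ∈? N))
... | yes found = found
... | no  none  = contradiction
  (λ {x} x∈M → decidable-stable (x ∈? N) (λ x∉N → none (x , x∈M , x∉N))) M⊈N

star-invariant : {R : Rel A 0ℓ} (Q : A → Set) →
  (∀ {u w} → R u w → Q u → Q w) → ∀ {u w} → Star R u w → Q u → Q w
star-invariant Q step = fold (λ u w → Q u → Q w) (λ r k q → k (step r q)) id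

-- Digraph isomorphisms and transitive orientations

digraphIso : {R : Rel A 0ℓ} {S : Rel B 0ℓ} {f : A → B} →
  Injective _≡_ _≡_ f → StrictlySurjective _≡_ f →
  R =[ f ]⇒ S → (∀ {v w} → S (f v) (f w) → R v w) → IsDigraphIso R S f
digraphIso {f = f} inj surj mono cancel = record
  { isOrderMonomorphism = record
    { isOrderHomomorphism = record { cong = cong f ; mono = mono }
    ; injective           = inj
    ; cancel              = cancel
    }
  ; surjective = strictlySurjective⇒surjective surj
  }

module DigraphIso {R : Rel A 0ℓ} {S : Rel B 0ℓ} {f : A → B} (iso : IsDigraphIso R S f) where

  open IsOrderIsomorphism iso public using (injective; mono; cancel)

  from : B → A
  from y = proj₁ (IsOrderIsomorphism.surjective iso y)

  to∘from : ∀ y → f (from y) ≡ y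
  to∘from y = proj₂ (IsOrderIsomorphism.surjective iso y) refl

  from∘to : ∀ x → from (f x) ≡ x
  from∘to x = injective (to∘from (f x))

flip-orientation : {G F : Rel A 0ℓ} → Symmetric G →
  IsTransitiveOrientation G F → IsTransitiveOrientation G (flip F)
flip-orientation G-sym o = record
  { arcs⇒edges = G-sym ∘ O.arcs⇒edges
  ; directed   = swap ∘ O.directed
  ; asym       = O.asym
  ; trans      = flip O.trans
  }
  where module O = IsTransitiveOrientation o

symClosure-orientation : {F : Rel A 0ℓ} → Asymmetric F → Transitive F →
                         IsTransitiveOrientation (SymClosure F) F
symClosure-orientation F-asym F-trans = record
  { arcs⇒edges = fwd
  ; directed   = λ { (fwd a) → inj₁ a ; (bwd a) → inj₂ a }
  ; asym       = F-asym
  ; trans      = F-trans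
  }

-- Each axiom of an orientation speaks only of given vertices, so it pulls back along `h`. In the
-- application `h` is the inverse of the glued map.
orientation-transport : {H F₁ F₂ : Rel A 0ℓ} (h : A → A) →
  (∀ v w → H (h v) (h w) ⇔ H v w) → (∀ v w → F₁ (h v) (h w) ⇔ F₂ v w) →
  IsTransitiveOrientation H F₁ → IsTransitiveOrientation H F₂
orientation-transport h H⇔ F⇔ o = record
  { arcs⇒edges = λ a → to (H⇔ _ _) (O.arcs⇒edges (from (F⇔ _ _) a))
  ; directed   = λ e → [ inj₁ ∘ to (F⇔ _ _) , inj₂ ∘ to (F⇔ _ _) ]′
                         (O.directed (from (H⇔ _ _) e))
  ; asym       = λ a b → O.asym (from (F⇔ _ _) a) (from (F⇔ _ _) b)
  ; trans      = λ a b → to (F⇔ _ _) (O.trans (from (F⇔ _ _) a) (from (F⇔ _ _) b))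
  }
  where
  module O = IsTransitiveOrientation o
  open Equivalence

complement-⇔ : {G : Rel A 0ℓ} {h : A → A} → Injective _≡_ _≡_ h →
  (∀ v w → G (h v) (h w) ⇔ G v w) →
  ∀ v w → Complement G (h v) (h w) ⇔ Complement G v w
complement-⇔ {h = h} h-inj G⇔ v w = mk⇔
  (λ (hv≢hw , ¬e) → (λ v≡w → hv≢hw (cong h v≡w)) , λ e → ¬e (from (G⇔ v w) e))
  (λ (v≢w , ¬e) → (λ hv≡hw → v≢w (h-inj hv≡hw)) , λ e → ¬e (to (G⇔ v w) e))
  where open Equivalence

-- The induced permutation

module TransitiveTournament
  {G F F₁ : Rel (Fin n) 0ℓ} (_G?_ : Decidable G) (G-sym : Symmetric G)
  (o : IsTransitiveOrientation G F) (o₁ : IsTransitiveOrientation (Complement G) F₁) where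

  private
    module O  = IsTransitiveOrientation o
    module O₁ = IsTransitiveOrientation o₁

  _⇝_ : Rel (Fin n) 0ℓ
  _⇝_ = F Union.∪ F₁

  ⇝-asym : Asymmetric _⇝_
  ⇝-asym (inj₁ a) (inj₁ b) = O.asym a b
  ⇝-asym (inj₁ a) (inj₂ b) = proj₂ (O₁.arcs⇒edges b) (G-sym (O.arcs⇒edges a))
  ⇝-asym (inj₂ a) (inj₁ b) = proj₂ (O₁.arcs⇒edges a) (G-sym (O.arcs⇒edges b))
  ⇝-asym (inj₂ a) (inj₂ b) = O₁.asym a b

  ⇝-irrefl : ∀ {v w} → v ≡ w → ¬ (v ⇝ w)
  ⇝-irrefl refl a = ⇝-asym a a

  ⇝-total : ∀ {v w} → v ≢ w → v ⇝ w ⊎ w ⇝ v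
  ⇝-total {v} {w} v≢w with v G? w
  ... | yes e = [ inj₁ ∘ inj₁ , inj₂ ∘ inj₁ ]′ (O.directed e)
  ... | no ¬e = [ inj₁ ∘ inj₂ , inj₂ ∘ inj₂ ]′ (O₁.directed (v≢w , ¬e))

  _⇝?_ : Decidable _⇝_
  v ⇝? w with v ≟ w
  ... | yes v≡w = no (⇝-irrefl v≡w)
  ... | no  v≢w = [ yes , no ∘ ⇝-asym ]′ (⇝-total v≢w)

  -- Two of the three arcs of a cyclic triangle belong to the same orientation.
  ⇝-acyclic : ∀ {u v w} → u ⇝ v → v ⇝ w → ¬ (w ⇝ u)
  ⇝-acyclic (inj₁ a) (inj₁ b) c        = ⇝-asym (inj₁ (O.trans a b)) c
  ⇝-acyclic (inj₂ a) (inj₂ b) c        = ⇝-asym (inj₂ (O₁.trans a b)) c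
  ⇝-acyclic (inj₁ a) (inj₂ b) (inj₁ c) = ⇝-asym (inj₁ (O.trans c a)) (inj₂ b)
  ⇝-acyclic (inj₁ a) (inj₂ b) (inj₂ c) = ⇝-asym (inj₂ (O₁.trans b c)) (inj₁ a)
  ⇝-acyclic (inj₂ a) (inj₁ b) (inj₁ c) = ⇝-asym (inj₁ (O.trans b c)) (inj₂ a)
  ⇝-acyclic (inj₂ a) (inj₁ b) (inj₂ c) = ⇝-asym (inj₂ (O₁.trans c a)) (inj₁ b)

  ⇝-trans : Transitive _⇝_
  ⇝-trans {u} {v} {w} a b with u ≟ w
  ... | yes refl = contradiction b (⇝-asym a)
  ... | no  u≢w  = [ id , (λ c → contradiction c (⇝-acyclic a b)) ]′ (⇝-total u≢w)

  private
    module Below (v : Fin n) = Comprehension {Q = _⇝ v} (_⇝? v)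

  below : Fin n → Subset n
  below v = Below.subset v

  ∣below∣<n : ∀ v → ∣ below v ∣ ℕ.< n
  ∣below∣<n v = subst (∣ below v ∣ ℕ.<_) (∣⊤∣≡n n)
    (p⊂q⇒∣p∣<∣q∣ ((λ _ → ∈⊤) , v , ∈⊤ , λ v∈ → ⇝-irrefl refl (Below.∈-subset⁻ v v∈)))

  -- The number of predecessors is the position in the linear order, counted from 0; this is the
  -- labelling `L`.
  rank : Fin n → Fin n
  rank v = fromℕ< (∣below∣<n v)

  rank-mono : ∀ {v w} → v ⇝ w → rank v < rank w
  rank-mono {v} {w} a =
    subst₂ ℕ._<_ (sym (toℕ-fromℕ< (∣below∣<n v))) (sym (toℕ-fromℕ< (∣below∣<n w)))
      (p⊂q⇒∣p∣<∣q∣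
        ( (λ u∈ → Below.∈-subset⁺ w (⇝-trans (Below.∈-subset⁻ v u∈) a))
        , v , Below.∈-subset⁺ w a , λ v∈ → ⇝-irrefl refl (Below.∈-subset⁻ v v∈)))

  rank-injective : Injective _≡_ _≡_ rank
  rank-injective {v} {w} eq with v ≟ w
  ... | yes v≡w = v≡w
  ... | no  v≢w = [ (λ a → contradiction (rank-mono a) (<-irrefl eq))
                  , (λ a → contradiction (rank-mono a) (<-irrefl (sym eq))) ]′ (⇝-total v≢w)

  rank-cancel : ∀ {v w} → rank v < rank w → v ⇝ w
  rank-cancel {v} {w} lt with v ≟ w
  ... | yes refl = contradiction lt (<-irrefl refl)
  ... | no  v≢w  = [ id , (λ a → contradiction (rank-mono a) (<-asym lt)) ]′ (⇝-total v≢w)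

  rank-iso : IsDigraphIso _⇝_ _<_ rank
  rank-iso = digraphIso rank-injective (injective⇒strictlySurjective rank-injective)
                        rank-mono rank-cancel

-- If L and L′ are the labellings of F ∪ F₁ and -F ∪ F₁, then π⁻¹ is L′ ∘ L⁻¹: the two
-- linear orders disagree exactly on the arcs of F.
inducedPermutation : {G F F₁ : Rel (Fin n) 0ℓ} → Decidable G → Symmetric G →
  IsTransitiveOrientation G F → IsTransitiveOrientation (Complement G) F₁ →
  ∃ λ (π : Permutation′ n) → Induces F F₁ π
inducedPermutation {n} {F = F} {F₁} G? G-sym o o₁ =
  π , T.rank , T.rank-iso , λ i j → mk⇔ (inversion⇒arc i j) (arc⇒inversion i j)
  where
  module T  = TransitiveTournament G? G-sym o o₁
  module T′ = TransitiveTournament G? G-sym (flip-orientation G-sym o) o₁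
  module L  = DigraphIso T.rank-iso
  module L′ = DigraphIso T′.rank-iso

  π : Permutation′ n
  π = permutation (T.rank ∘ L′.from) (T′.rank ∘ L.from)
    (λ y → trans (cong T.rank (L′.from∘to (L.from y))) (L.to∘from y))
    (λ y → trans (cong T′.rank (L.from∘to (L′.from y))) (L′.to∘from y))

  inversion⇒arc : ∀ i j → InversionSet π i j →
                  ∃₂ λ v w → F v w × T.rank v ≡ i × T.rank w ≡ j
  inversion⇒arc i j (i<j , π⁻¹j<π⁻¹i)
    with L.cancel (subst₂ _<_ (sym (L.to∘from i)) (sym (L.to∘from j)) i<j)
       | L′.cancel π⁻¹j<π⁻¹i
  ... | _ | inj₁ a = L.from i , L.from j , a , L.to∘from i , L.to∘from j
  -- An arc of `F₁` has the same direction in both tournaments, so the two orders cannot disagree on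
  -- it.
  ... | a | inj₂ b = contradiction (inj₂ b) (T.⇝-asym a)

  arc⇒inversion : ∀ i j → (∃₂ λ v w → F v w × T.rank v ≡ i × T.rank w ≡ j) →
                  InversionSet π i j
  arc⇒inversion _ _ (v , w , a , refl , refl) =
    T.rank-mono (inj₁ a) ,
    subst₂ (λ x y → T′.rank x < T′.rank y) (sym (L.from∘to w)) (sym (L.from∘to v))
      (T′.rank-mono (inj₁ a))

-- Relabelling by `L ∘ h` moves no arc of `F` to a new pair of labels, since `h` preserves `F`; and
-- the inversions of `π` are exactly these pairs.
induces-transport : {F F₁ F₂ : Rel (Fin n) 0ℓ} {f h : Fin n → Fin n} →
  (∀ v → f (h v) ≡ v) → (∀ v → h (f v) ≡ v) →
  (∀ v w → F (h v) (h w) ⇔ F v w) → (∀ v w → F₁ (h v) (h w) ⇔ F₂ v w) →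
  ∀ π → Induces F F₁ π → Induces F F₂ π
induces-transport {F = F} {f = f} {h} f∘h h∘f F⇔ F₁⇔ _ (L , L-iso , inv⇔) =
  L ∘ h ,
  digraphIso
    (λ eq → trans (sym (f∘h _)) (trans (cong f (L.injective eq)) (f∘h _)))
    (λ y → f (L.from y) , trans (cong L (h∘f (L.from y))) (L.to∘from y))
    (λ { (inj₁ a) → L.mono (inj₁ (from (F⇔ _ _) a))
       ; (inj₂ a) → L.mono (inj₂ (from (F₁⇔ _ _) a)) })
    (λ lt → [ inj₁ ∘ to (F⇔ _ _) , inj₂ ∘ to (F₁⇔ _ _) ]′ (L.cancel lt)) ,
  λ i j → mk⇔
    (λ inv → let v , w , a , Lv≡i , Lw≡j = to (inv⇔ i j) inv in
      f v , f w ,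
      to (F⇔ _ _) (subst₂ F (sym (h∘f v)) (sym (h∘f w)) a) ,
      trans (cong L (h∘f v)) Lv≡i , trans (cong L (h∘f w)) Lw≡j)
    (λ (v , w , a , Lhv≡i , Lhw≡j) →
      from (inv⇔ i j) (h v , h w , from (F⇔ _ _) a , Lhv≡i , Lhw≡j))
  where
  module L = DigraphIso L-iso
  open Equivalence

-- Permutation digraphs

module PermutationDigraph {F : Rel (Fin n) 0ℓ} (perm : IsPermutationDigraph F) where

  private
    π = proj₁ (proj₂ perm)
    φ = proj₁ (proj₂ (proj₂ perm))
    module φ = DigraphIso (proj₂ (proj₂ (proj₂ perm)))

  -- All later case distinctions on edges rest on this; it is read off from the isomorphic inversion
  -- set.
  _F?_ : Decidable F
  v F? w = map′ φ.cancel φ.mono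
    ((φ v <? φ w) ×-dec ((π ⟨$⟩ˡ φ w) <? (π ⟨$⟩ˡ φ v)))

  F-asym : Asymmetric F
  F-asym a b = <-asym (proj₁ (φ.mono a)) (proj₁ (φ.mono b))

  -- An inversion set is the intersection of two strict orders: that of the labels and the reverse
  -- of their order under the inverse permutation.
  F-trans : Transitive F
  F-trans a b with φ.mono a | φ.mono b
  ... | i<j , j′<i′ | j<k , k′<j′ = φ.cancel (<-trans i<j j<k , <-trans k′<j′ j′<i′)

symClosure? : {F : Rel A 0ℓ} → Decidable F → Decidable (SymClosure F)
symClosure? _F?_ v w with v F? w | w F? v
... | yes a | _     = yes (fwd a)
... | no  _ | yes a = yes (bwd a)
... | no ¬a | no ¬b = no λ { (fwd a) → ¬a a ; (bwd b) → ¬b b }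

-- Modules

module-uniform : {G : Rel (Fin n) 0ℓ} {M : Subset n} → IsModule G M →
  ∀ {v x y} → v ∉ M → x ∈ M → y ∈ M → G v x → G v y
module-uniform mod v∉M x∈M y∈M e with mod v∉M
... | inj₁ all  = all y∈M
... | inj₂ none = contradiction e (none x∈M)

-- The common vertex `b` forces the verdicts of `M` and `N` on an outside vertex to coincide.
∪-isModule : {G : Rel (Fin n) 0ℓ} {M N : Subset n} {b : Fin n} →
  IsModule G M → IsModule G N → b ∈ M → b ∈ N → IsModule G (M ∪ N)
∪-isModule {M = M} {N} modM modN b∈M b∈N v∉
  with modM (v∉ ∘ p⊆p∪q N) | modN (v∉ ∘ q⊆p∪q M N)
... | inj₁ allM  | inj₁ allN  = inj₁ ([ allM , allN ]′ ∘ x∈p∪q⁻ M N)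
... | inj₂ noneM | inj₂ noneN = inj₂ ([ noneM , noneN ]′ ∘ x∈p∪q⁻ M N)
... | inj₁ allM  | inj₂ noneN = contradiction (allM b∈M) (noneN b∈N)
... | inj₂ noneM | inj₁ allN  = contradiction (allN b∈N) (noneM b∈M)

⁅⁆-isModule : {G : Rel (Fin n) 0ℓ} → Decidable G → ∀ x → IsModule G ⁅ x ⁆
⁅⁆-isModule {G = G} _G?_ x {v} _ with v G? x
... | yes e = inj₁ (λ y∈ → subst (G v) (sym (x∈⁅y⁆⇒x≡y x y∈)) e)
... | no ¬e = inj₂ (λ y∈ e → ¬e (subst (G v) (x∈⁅y⁆⇒x≡y x y∈) e))

-- The direction is constant along a walk of the complement: for non-adjacent `u`, `u′` in `P`, arcs
-- from `u` to `w` and from `w` to `u′` would compose to an arc between them.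
module-uniform-arcs : {G F : Rel (Fin n) 0ℓ} {P : Subset n} → Symmetric G →
  IsTransitiveOrientation G F → IsModule G P → Connected (Complement G ∣ᵢ P) →
  ∀ {w x y} → w ∉ P → x ∈ P → y ∈ P → F x w → F y w
module-uniform-arcs {G = G} {F} {P} G-sym o mod coconn {w} w∉P x∈P y∈P =
  star-invariant (λ u → F (proj₁ u) w) (λ {u} {u′} → step {u} {u′}) (coconn (_ , x∈P) (_ , y∈P))
  where
  module O = IsTransitiveOrientation o

  step : ∀ {u u′} → (Complement G ∣ᵢ P) u u′ → F (proj₁ u) w → F (proj₁ u′) w
  step {u , u∈P} {u′ , u′∈P} (_ , ¬e) a =
    [ (λ w→u′ → contradiction (O.arcs⇒edges (O.trans a w→u′)) ¬e) , id ]′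
      (O.directed (module-uniform {G = G} mod w∉P u∈P u′∈P (G-sym (O.arcs⇒edges a))))

-- Implication classes and the triangle lemma

-- The undirected implication class of x₀y₀ in the subgraph induced by P: xy forces xz
-- whenever y and z are not adjacent.
data Forced {n : ℕ} (G : Rel (Fin n) 0ℓ) (P : Subset n) (x₀ y₀ : Fin n) :
            Fin n → Fin n → Set where
  base : Forced G P x₀ y₀ x₀ y₀
  turn : ∀ {x y} → Forced G P x₀ y₀ x y → Forced G P x₀ y₀ y x
  step : ∀ {x y z} → Forced G P x₀ y₀ x y → z ∈ P → G x z → ¬ G y z → Forced G P x₀ y₀ x z

module ImplicationClass {G : Rel (Fin n) 0ℓ} (_G?_ : Decidable G) (G-sym : Symmetric G)
                        {P : Subset n} where

  Edge : Rel (Fin n) 0ℓ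
  Edge x y = x ∈ P × y ∈ P × G x y

  Touched : Fin n → Fin n → Fin n → Set
  Touched x₀ y₀ x = ∃ (Forced G P x₀ y₀ x)

  forced-edge : ∀ {x₀ y₀ x y} → Edge x₀ y₀ → Forced G P x₀ y₀ x y → Edge x y
  forced-edge e base             = e
  forced-edge e (turn c)         =
    let x∈P , y∈P , xy = forced-edge e c in y∈P , x∈P , G-sym xy
  forced-edge e (step c z∈P g _) = proj₁ (forced-edge e c) , z∈P , g

  forced-trans : ∀ {x₀ y₀ x₁ y₁ x y} →
    Forced G P x₀ y₀ x₁ y₁ → Forced G P x₁ y₁ x y → Forced G P x₀ y₀ x y
  forced-trans c base               = c
  forced-trans c (turn d)           = turn (forced-trans c d)
  forced-trans c (step d z∈P g ¬g) = step (forced-trans c d) z∈P g ¬g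

  -- A forcing step is undone by a step that uses the same non-adjacent pair in the other order.
  forced-sym : ∀ {x₀ y₀ x y} → Edge x₀ y₀ → Forced G P x₀ y₀ x y → Forced G P x y x₀ y₀
  forced-sym e base               = base
  forced-sym e (turn c)           = forced-trans (turn base) (forced-sym e c)
  forced-sym e (step c z∈P g ¬g) =
    let _ , y∈P , xy = forced-edge e c in
    forced-trans (step base y∈P xy (¬g ∘ G-sym)) (forced-sym e c)

  module _ {x₀ y₀ : Fin n} where

    private
      C = Forced G P x₀ y₀

    -- If `v` saw `x` but not `y`, the edge `xy` would force `xv` and so touch `v`.
    untouched-uniform : ∀ {v} → v ∈ P → ¬ Touched x₀ y₀ v →
                        ∀ {x y} → C x y → G v x → G v y
    untouched-uniform {v} v∈P v∉C {x} {y} c vx = decidable-stable (v G? y)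
      (λ ¬vy → v∉C (x , turn (step c v∈P (G-sym vx) (¬vy ∘ G-sym))))

    -- Both ends are compared with `x₀` at once, so that `turn` merely swaps the two comparisons.
    untouched⇔ : ∀ {v} → v ∈ P → ¬ Touched x₀ y₀ v → ∀ {x y} → C x y →
      ((G v x₀ → G v x) × (G v x → G v x₀)) × ((G v x₀ → G v y) × (G v y → G v x₀))
    untouched⇔ v∈P v∉C base =
      (id , id) ,
      (untouched-uniform v∈P v∉C base , untouched-uniform v∈P v∉C (turn base))
    untouched⇔ v∈P v∉C (turn c) =
      let hx , hy = untouched⇔ v∈P v∉C c in hy , hx
    untouched⇔ v∈P v∉C (step c z∈P g ¬g) =
      let (to , from) , _ = untouched⇔ v∈P v∉C c
          d               = step c z∈P g ¬g
      in (to , from) ,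
         (untouched-uniform v∈P v∉C d ∘ to , from ∘ untouched-uniform v∈P v∉C (turn d))

    -- Vertices outside `P` are handled by `modP`, untouched ones in `P` by comparison with `x₀`. As
    -- `Touched` is undecided, its extent is supplied as a subset `M`.
    span-isModule : IsModule G P → {M : Subset n} → M ⊆ P →
      (∀ {x} → Touched x₀ y₀ x → x ∈ M) → (∀ {x} → x ∈ M → Touched x₀ y₀ x) → IsModule G M
    span-isModule modP M⊆P M⁺ M⁻ {v} v∉M with v ∈? P
    ... | no v∉P with modP v∉P
    ...   | inj₁ all  = inj₁ (all ∘ M⊆P)
    ...   | inj₂ none = inj₂ (none ∘ M⊆P)
    span-isModule modP M⊆P M⁺ M⁻ {v} v∉M | yes v∈P with v G? x₀
    ... | yes e = inj₁ λ x∈M → proj₁ (proj₁ (untouched⇔ v∈P (v∉M ∘ M⁺) (proj₂ (M⁻ x∈M)))) e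
    ... | no ¬e = inj₂ λ x∈M → ¬e ∘ proj₂ (proj₁ (untouched⇔ v∈P (v∉M ∘ M⁺) (proj₂ (M⁻ x∈M))))

    -- Golumbic's triangle lemma.
    triangle : Edge x₀ y₀ → ∀ {z} → z ∈ P →
      G z x₀ → ¬ C z x₀ → G z y₀ → ¬ C z y₀ →
      ∀ {x y} → C x y → (G z x × ¬ C z x) × (G z y × ¬ C z y)
    triangle e z∈P zx ¬cx zy ¬cy base     = (zx , ¬cx) , (zy , ¬cy)
    triangle e z∈P zx ¬cx zy ¬cy (turn c) =
      let tx , ty = triangle e z∈P zx ¬cx zy ¬cy c in ty , tx
    triangle e {z} z∈P zx₀ ¬cx₀ zy₀ ¬cy₀ (step {x} {y} {w} c w∈P xw ¬yw)
      with triangle e z∈P zx₀ ¬cx₀ zy₀ ¬cy₀ c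
    -- Without an edge `zw`, the class edge `xw` would force `xz`; and were `zw` in the class, it
    -- would force `zy`, because `w` and `y` are not adjacent.
    ... | (zx , ¬cx) , (zy , ¬cy) = (zx , ¬cx) , (zw , ¬cw)
      where
      zw : G z w
      zw = decidable-stable (z G? w) λ ¬zw →
        ¬cx (turn (step (step c w∈P xw ¬yw) z∈P (G-sym zx) (¬zw ∘ G-sym)))

      ¬cw : ¬ C z w
      ¬cw cw = ¬cy (step cw (proj₁ (proj₂ (forced-edge e c))) zy (¬yw ∘ G-sym))

    -- A class edge at `z` would, by `triangle`, make `z` adjacent to itself.
    apex-untouched : (∀ {x} → ¬ G x x) → Edge x₀ y₀ → ∀ {z} → z ∈ P →
      G z x₀ → ¬ C z x₀ → G z y₀ → ¬ C z y₀ → ¬ Touched x₀ y₀ z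
    apex-untouched irrefl e z∈P zx ¬cx zy ¬cy (_ , c) =
      irrefl (proj₁ (proj₁ (triangle e z∈P zx ¬cx zy ¬cy c)))

  -- Of two distinct classes that both span P, take an edge of each at a common vertex x₁;
  -- the third side of the triangle puts one of them out of reach of a vertex it touches.
  spanning-classes-meet : (∀ {x} → ¬ G x x) → ∀ {x₀ y₀ x₁ y₁} → Edge x₀ y₀ → Edge x₁ y₁ →
    (∀ {z} → z ∈ P → ¬ ¬ Touched x₀ y₀ z) → (∀ {z} → z ∈ P → ¬ ¬ Touched x₁ y₁ z) →
    ¬ ¬ Forced G P x₀ y₀ x₁ y₁
  spanning-classes-meet irrefl {x₀} {y₀} {x₁} {z} e₀ e₁@(x∈P , z∈P , xz) span₀ span₁ ¬c =
    span₀ x∈P λ (y , xy∈C₀) → ¬¬-excluded-middle λ yz∈C₀? → apex y xy∈C₀ yz∈C₀?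
    where
    C₀ = Forced G P x₀ y₀

    apex : ∀ y → C₀ x₁ y → ¬ Dec (C₀ y z)
    apex y xy∈C₀ yz∈C₀? = third yz∈C₀?
      where
      exy : Edge x₁ y
      exy = forced-edge e₀ xy∈C₀

      y∈P = proj₁ (proj₂ exy)
      xy  = proj₂ (proj₂ exy)

      -- Otherwise `x₁y` would force `x₁z`, and the classes would coincide.
      yz : G y z
      yz = decidable-stable (y G? z) (λ ¬yz → ¬c (step xy∈C₀ z∈P xz ¬yz))

      disjoint : ∀ {a b} → C₀ a b → ¬ Forced G P x₁ z a b
      disjoint c₀ c₁ = ¬c (forced-trans c₀ (forced-sym e₁ c₁))

      third : ¬ Dec (C₀ y z)
      -- Apex `y` over the base `x₁z`: both sides lie in `C₀`, hence outside the class of the base.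
      third (yes yz∈C₀) = span₁ y∈P
        (apex-untouched irrefl e₁ y∈P (G-sym xy) (disjoint (turn xy∈C₀)) yz (disjoint yz∈C₀))
      -- Apex `z` over the base `x₁y`: neither side lies in `C₀`, which is rerooted at this base.
      third (no yz∉C₀) = span₀ z∈P λ (w , zw∈C₀) →
        apex-untouched irrefl exy z∈P
          (G-sym xz) (λ c → ¬c (turn (forced-trans xy∈C₀ c)))
          (G-sym yz) (λ c → yz∉C₀ (turn (forced-trans xy∈C₀ c)))
          (w , forced-trans (forced-sym e₀ xy∈C₀) zw∈C₀)

-- The children of a prime node

module PrimeNode {G : Rel (Fin n) 0ℓ} (_G?_ : Decidable G) (G-sym : Symmetric G)
                 {P : Subset n} (prime : IsPrimeNode G P)
                 {X : Fin p → Subset n} (children : EnumeratesChildren G P X) where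

  open IsPrimeNode prime
  open EnumeratesChildren children
  private
    module Child i = IsMaximalProperSubmodule (child i)

  P-isModule : IsModule G P
  P-isModule = proj₁ strong

  child-⊆ : ∀ {i} → X i ⊆ P
  child-⊆ {i} = proj₁ (Child.proper i)

  -- Two overlapping children have union P, and then P is split into X i ∖ X k and X k
  -- with either all or no edges between the two parts.
  child-unique : ∀ {i k b} → b ∈ X i → b ∈ X k → i ≡ k
  child-unique {i} {k} {b} b∈Xi b∈Xk = decidable-stable (i ≟ k) not-distinct
    where
    not-distinct : ¬ (i ≢ k)
    not-distinct i≢k = split (x₀ G? y₀)
      where
      modi = Child.isModule i
      modk = Child.isModule k

      -- If it were not all of `P`, the union would be a proper submodule, equal to both children by
      -- maximality.
      covers : ∀ {x} → x ∈ P → x ∈ X i ∪ X k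
      covers {x} x∈P = decidable-stable (x ∈? (X i ∪ X k)) λ x∉U →
        let U⊂P : X i ∪ X k ⊂ P
            U⊂P  = (λ u∈ → [ child-⊆ , child-⊆ ]′ (x∈p∪q⁻ (X i) (X k) u∈)) , x , x∈P , x∉U
            modU = ∪-isModule {G = G} modi modk b∈Xi b∈Xk
        in i≢k (distinct (trans (sym (Child.maximal i (X i ∪ X k) modU U⊂P (p⊆p∪q (X k))))
                                (Child.maximal k (X i ∪ X k) modU U⊂P (q⊆p∪q (X i) (X k)))))

      in-i : ∀ {x} → x ∈ P → x ∉ X k → x ∈ X i
      in-i x∈P x∉Xk = [ id , (λ x∈Xk → contradiction x∈Xk x∉Xk) ]′ (x∈p∪q⁻ (X i) (X k) (covers x∈P))

      -- Both vertices witness properness: `x₀` avoids `X k`, so it lies in `X i`, and `y₀` avoids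
      -- `X i`, so it lies in `X k`.
      x₀ = proj₁ (proj₂ (Child.proper k))
      y₀ = proj₁ (proj₂ (Child.proper i))

      x₀∈P : x₀ ∈ P
      x₀∈P = proj₁ (proj₂ (proj₂ (Child.proper k)))

      x₀∉Xk : x₀ ∉ X k
      x₀∉Xk = proj₂ (proj₂ (proj₂ (Child.proper k)))

      y₀∈P : y₀ ∈ P
      y₀∈P = proj₁ (proj₂ (proj₂ (Child.proper i)))

      y₀∉Xi : y₀ ∉ X i
      y₀∉Xi = proj₂ (proj₂ (proj₂ (Child.proper i)))

      y₀∈Xk : y₀ ∈ X k
      y₀∈Xk = [ (λ y₀∈Xi → contradiction y₀∈Xi y₀∉Xi) , id ]′ (x∈p∪q⁻ (X i) (X k) (covers y₀∈P))

      -- First move `y` to `y₀` inside the module `X k`, then `x` to `x₀` inside `X i`, seen from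
      -- `y₀`.
      toward : ∀ {x y} → x ∈ P → x ∉ X k → y ∈ X k → G x y → G x₀ y₀
      toward x∈P x∉Xk y∈Xk = G-sym
        ∘ module-uniform {G = G} modi y₀∉Xi (in-i x∈P x∉Xk) (in-i x₀∈P x₀∉Xk)
        ∘ G-sym ∘ module-uniform {G = G} modk x∉Xk y∈Xk y₀∈Xk

      back : ∀ {x y} → x ∈ P → x ∉ X k → y ∈ X k → G x₀ y₀ → G x y
      back x∈P x∉Xk y∈Xk = module-uniform {G = G} modk x∉Xk y₀∈Xk y∈Xk
        ∘ G-sym ∘ module-uniform {G = G} modi y₀∉Xi (in-i x₀∈P x₀∉Xk) (in-i x∈P x∉Xk)
        ∘ G-sym

      split : ¬ Dec (G x₀ y₀)
      split (yes e) = star-invariant (λ u → proj₁ u ∉ X k)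
        (λ {u} (_ , ¬e) u∉Xk w∈Xk → ¬e (back (proj₂ u) u∉Xk w∈Xk e))
        (coconnected (x₀ , x₀∈P) (y₀ , y₀∈P)) x₀∉Xk y₀∈Xk
      split (no ¬e) = star-invariant (λ u → proj₁ u ∉ X k)
        (λ {u} e u∉Xk w∈Xk → ¬e (toward (proj₂ u) u∉Xk w∈Xk e))
        (connected (x₀ , x₀∈P) (y₀ , y₀∈P)) x₀∉Xk y₀∈Xk

  -- If `N` lies in no child, neither does any larger proper submodule; by induction there is none,
  -- so `N` is itself a child. The double negation avoids deciding maximality.
  ⊆-child : ∀ N → Acc _⊃_ N → IsModule G N → N ⊂ P → ¬ ¬ (∃ λ i → N ⊆ X i)
  ⊆-child N (acc rec) modN N⊂P none =
    let i , Xi≡N = complete N (record { isModule = modN ; proper = N⊂P ; maximal = N-maximal })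
    in none (i , λ {x} → subst (x ∈_) (sym Xi≡N))
    where
    N-maximal : ∀ Y → IsModule G Y → Y ⊂ P → N ⊆ Y → Y ≡ N
    N-maximal Y modY Y⊂P N⊆Y with Y ⊆? N
    ... | yes Y⊆N = ⊆-antisym Y⊆N N⊆Y
    ... | no  Y⊈N = contradiction (λ (j , Y⊆Xj) → none (j , λ x∈N → Y⊆Xj (N⊆Y x∈N)))
                      (⊆-child Y (rec ((λ {x} → N⊆Y {x}) , ⊈⇒∃ Y⊈N)) modY Y⊂P)

  -- The singleton of `v` is a module, proper because `P` has more than one vertex. Searching the
  -- finitely many children is decidable, which removes the double negation of `⊆-child`.
  child-of : ∀ {v} → v ∈ P → ∃ λ i → v ∈ X i
  child-of {v} v∈P = decidable-stable (any? (λ i → v ∈? X i)) λ none →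
    ⊆-child ⁅ v ⁆ (⊃-wellFounded ⁅ v ⁆) (⁅⁆-isModule _G?_ v) ⁅v⁆⊂P
      (λ (i , ⁅v⁆⊆Xi) → none (i , ⁅v⁆⊆Xi (x∈⁅x⁆ v)))
    where
    P⊈⁅v⁆ : P ⊈ ⁅ v ⁆
    P⊈⁅v⁆ P⊆⁅v⁆ = ℕ.<⇒≱ nontrivial (subst (∣ P ∣ ℕ.≤_) (∣⁅x⁆∣≡1 v) (p⊆q⇒∣p∣≤∣q∣ P⊆⁅v⁆))

    ⁅v⁆⊂P : ⁅ v ⁆ ⊂ P
    ⁅v⁆⊂P = (λ x∈ → subst (_∈ P) (sym (x∈⁅y⁆⇒x≡y v x∈)) v∈P) , ⊈⇒∃ P⊈⁅v⁆

  -- A module strictly inside `P` would lie within a single child.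
  module-across-children : ∀ {N i j a b} → IsModule G N → N ⊆ P →
    a ∈ N → a ∈ X i → b ∈ N → b ∈ X j → i ≢ j → P ⊆ N
  module-across-children {N} modN N⊆P a∈N a∈Xi b∈N b∈Xj i≢j {x} x∈P =
    decidable-stable (x ∈? N) λ x∉N →
      ⊆-child N (⊃-wellFounded N) modN ((λ {y} → N⊆P {y}) , x , x∈P , x∉N)
        (λ (k , N⊆Xk) → i≢j (trans (child-unique a∈Xi (N⊆Xk a∈N))
                                   (child-unique (N⊆Xk b∈N) b∈Xj)))

  quotient-edge⁺ : ∀ {i j x y} → i ≢ j → x ∈ X i → y ∈ X j → G x y → Quotient G X i j
  quotient-edge⁺ i≢j x∈Xi y∈Xj e = i≢j , _ , _ , x∈Xi , y∈Xj , e

  quotient-edge⁻ : ∀ {i j x y} → Quotient G X i j → x ∈ X i → y ∈ X j → G x y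
  quotient-edge⁻ (i≢j , x′ , y′ , x′∈Xi , y′∈Xj , e) x∈Xi y∈Xj =
    G-sym (module-uniform {G = G} (Child.isModule _) (λ y∈Xi → i≢j (child-unique y∈Xi y∈Xj))
      x′∈Xi x∈Xi (G-sym
        (module-uniform {G = G} (Child.isModule _) (λ x′∈Xj → i≢j (child-unique x′∈Xi x′∈Xj))
          y′∈Xj y∈Xj e)))

  quotient-sym : Symmetric (Quotient G X)
  quotient-sym (i≢j , x , y , x∈Xi , y∈Xj , e) = ≢-sym i≢j , y , x , y∈Xj , x∈Xi , G-sym e

  -- Edges between children and the uniqueness of the orientation

  open ImplicationClass _G?_ G-sym {P}

  crossing-class-spans : ∀ {x y i j} → x ∈ X i → y ∈ X j → Quotient G X i j →
                         ∀ {z} → z ∈ P → ¬ ¬ Touched x y z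
  crossing-class-spans {x} {y} x∈Xi y∈Xj q {z} z∈P untouched =
    -- Under the double negation, `Touched` is decided for all of the finitely many vertices at
    -- once, so that its extent becomes a `Subset`.
    sequence (RawMonad.rawApplicative ¬¬-Monad) (λ _ → ¬¬-excluded-middle) λ T? →
      let open Comprehension {Q = Touched x y} T?
          e        = child-⊆ x∈Xi , child-⊆ y∈Xj , quotient-edge⁻ q x∈Xi y∈Xj
          subset⊆P = λ {u} (u∈ : u ∈ subset) → proj₁ (forced-edge e (proj₂ (∈-subset⁻ u∈)))
      in untouched (∈-subset⁻ (module-across-children
           (span-isModule P-isModule subset⊆P ∈-subset⁺ ∈-subset⁻) subset⊆P
           (∈-subset⁺ (_ , base)) x∈Xi (∈-subset⁺ (_ , turn base)) y∈Xj (proj₁ q) z∈P))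

  -- Arc and quotient arc are kept together, so that `flip F` with `flip Fᴾ` expresses their
  -- simultaneous reversal along a class.
  Agree : Rel (Fin n) 0ℓ → Rel (Fin p) 0ℓ → Rel (Fin n) 0ℓ
  Agree F Fᴾ x y = F x y × ∃₂ λ i j → x ∈ X i × y ∈ X j × Fᴾ i j

  -- The opposite direction at `x` would compose to an edge `yz`, in `G` as well as in the quotient.
  agree-step : {F : Rel (Fin n) 0ℓ} {Fᴾ : Rel (Fin p) 0ℓ} →
    IsTransitiveOrientation G F → IsTransitiveOrientation (Quotient G X) Fᴾ →
    ∀ {x y z} → z ∈ P → G x z → ¬ G y z → Agree F Fᴾ x y → Agree F Fᴾ x z
  agree-step {F} {Fᴾ} o oᴾ {x} {y} {z} z∈P xz ¬yz (x→y , i , j , x∈Xi , y∈Xj , i→j) =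
    x→z , i , k , x∈Xi , z∈Xk , i→k
    where
    module O  = IsTransitiveOrientation o
    module Oᴾ = IsTransitiveOrientation oᴾ

    k    = proj₁ (child-of z∈P)
    z∈Xk = proj₂ (child-of z∈P)

    x→z : F x z
    x→z = [ id , (λ z→x → contradiction (G-sym (O.arcs⇒edges (O.trans z→x x→y))) ¬yz) ]′
            (O.directed xz)

    i≢j = proj₁ (Oᴾ.arcs⇒edges i→j)

    -- Were `z` in the child of `x`, then `y`, being adjacent to `x`, would also be adjacent to `z`.
    i≢k : i ≢ k
    i≢k i≡k = ¬yz (module-uniform {G = G} (Child.isModule i)
      (λ y∈Xi → i≢j (child-unique y∈Xi y∈Xj))
      x∈Xi (subst (λ l → z ∈ X l) (sym i≡k) z∈Xk) (G-sym (O.arcs⇒edges x→y)))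

    i→k : Fᴾ i k
    i→k = [ id
          , (λ k→i → contradiction
              (G-sym (quotient-edge⁻ (Oᴾ.arcs⇒edges (Oᴾ.trans k→i i→j)) z∈Xk y∈Xj)) ¬yz) ]′
            (Oᴾ.directed (quotient-edge⁺ i≢k x∈Xi z∈Xk xz))

  agree-forced : {F : Rel (Fin n) 0ℓ} {Fᴾ : Rel (Fin p) 0ℓ} →
    IsTransitiveOrientation G F → IsTransitiveOrientation (Quotient G X) Fᴾ →
    ∀ {x₀ y₀ x y} → Agree F Fᴾ x₀ y₀ → Forced G P x₀ y₀ x y →
    Agree F Fᴾ x y ⊎ Agree (flip F) (flip Fᴾ) x y
  agree-forced o oᴾ a base     = inj₁ a
  agree-forced o oᴾ a (turn c) with agree-forced o oᴾ a c
  ... | inj₁ (f , i , j , x∈ , y∈ , fᴾ) = inj₂ (f , j , i , y∈ , x∈ , fᴾ)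
  ... | inj₂ (f , i , j , x∈ , y∈ , fᴾ) = inj₁ (f , j , i , y∈ , x∈ , fᴾ)
  agree-forced o oᴾ a (step c z∈P g ¬g) with agree-forced o oᴾ a c
  ... | inj₁ b = inj₁ (agree-step o oᴾ z∈P g ¬g b)
  ... | inj₂ b = inj₂ (agree-step (flip-orientation G-sym o)
                                  (flip-orientation quotient-sym oᴾ) z∈P g ¬g b)

  -- Gallai's uniqueness theorem, relating F to Fᴾ without first showing that F induces an
  -- orientation of the quotient.
  orientation-unique : {F : Rel (Fin n) 0ℓ} {Fᴾ : Rel (Fin p) 0ℓ} → (∀ {x} → ¬ G x x) →
    IsTransitiveOrientation G F → IsTransitiveOrientation (Quotient G X) Fᴾ →
    ∀ {v w v′ w′ i j i′ j′} → v ∈ X i → w ∈ X j → v′ ∈ X i′ → w′ ∈ X j′ →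
    Fᴾ i j → Fᴾ i′ j′ → F v w → F v′ w′
  orientation-unique {F} {Fᴾ} irrefl o oᴾ {v} {w} {v′} {w′} {i} {j} {i′} {j′}
    v∈ w∈ v′∈ w′∈ i→j i′→j′ v→w =
    -- The doubly negated `meet` can only refute the opposite arc; `directed` then yields the
    -- desired one.
    [ id , (λ w′→v′ → contradiction (refute w′→v′) meet) ]′
      (O.directed (quotient-edge⁻ q′ v′∈ w′∈))
    where
    module O  = IsTransitiveOrientation o
    module Oᴾ = IsTransitiveOrientation oᴾ

    q  = Oᴾ.arcs⇒edges i→j
    q′ = Oᴾ.arcs⇒edges i′→j′

    meet : ¬ ¬ Forced G P v w v′ w′
    meet = spanning-classes-meet irrefl
      (child-⊆ v∈  , child-⊆ w∈  , quotient-edge⁻ q v∈ w∈)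
      (child-⊆ v′∈ , child-⊆ w′∈ , quotient-edge⁻ q′ v′∈ w′∈)
      (crossing-class-spans v∈ w∈ q) (crossing-class-spans v′∈ w′∈ q′)

    refute : F w′ v′ → ¬ Forced G P v w v′ w′
    refute w′→v′ c with agree-forced o oᴾ (v→w , i , j , v∈ , w∈ , i→j) c
    ... | inj₁ (v′→w′ , _) = O.asym v′→w′ w′→v′
    ... | inj₂ (_ , a , b , v′∈Xa , w′∈Xb , b→a) = Oᴾ.asym i′→j′
      (subst₂ Fᴾ (child-unique w′∈Xb w′∈) (child-unique v′∈Xa v′∈) b→a)

-- The glued automorphism

vertices-≡ : {M : Subset n} {a b : Vertices M} → proj₁ a ≡ proj₁ b → a ≡ b
vertices-≡ {a = v , v∈} {b = .v , v∈′} refl = cong (v ,_) ([]=-irrelevant v∈ v∈′)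

module _ (X : Fin p → Subset n) (fᴾ : Fin p → Fin p)
         (g : ∀ i → Vertices (X i) → Vertices (X (fᴾ i))) where

  -- The search may return another index and membership proof; disjointness identifies the former,
  -- proof irrelevance the latter.
  glue-inside : (∀ {i k b} → b ∈ X i → b ∈ X k → i ≡ k) →
    ∀ {i v} (v∈Xi : v ∈ X i) → glue X fᴾ g v ≡ proj₁ (g i (v , v∈Xi))
  glue-inside unique {i} {v} v∈Xi with any? (λ k → v ∈? X k)
  ... | no none = contradiction (i , v∈Xi) none
  ... | yes (k , v∈Xk) with refl ← unique v∈Xk v∈Xi =
    cong (proj₁ ∘ g i) (vertices-≡ refl)

  glue-outside : ∀ {v} → (∀ i → v ∉ X i) → glue X fᴾ g v ≡ v
  glue-outside {v} outside with any? (λ k → v ∈? X k)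
  ... | no  _          = refl
  ... | yes (k , v∈Xk) = contradiction v∈Xk (outside k)

module GluedAutomorphism
  {G F : Rel (Fin n) 0ℓ} (G? : Decidable G) (G-sym : Symmetric G)
  (o : IsTransitiveOrientation G F)
  {P : Subset n} (prime : IsPrimeNode G P)
  {X : Fin p → Subset n} (children : EnumeratesChildren G P X)
  {Fᴾ : Rel (Fin p) 0ℓ} (oᴾ : IsTransitiveOrientation (Quotient G X) Fᴾ)
  {fᴾ : Fin p → Fin p} (fᴾ-iso : IsDigraphIso Fᴾ Fᴾ fᴾ)
  (g : ∀ i → Vertices (X i) → Vertices (X (fᴾ i)))
  (g-iso : ∀ i → IsDigraphIso (F ∣ᵢ X i) (F ∣ᵢ X (fᴾ i)) (g i)) where

  open PrimeNode G? G-sym prime children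
  private
    module O  = IsTransitiveOrientation o
    module Oᴾ = IsTransitiveOrientation oᴾ
    module Fᴾ = DigraphIso fᴾ-iso
    module g i = DigraphIso (g-iso i)

    f : Fin n → Fin n
    f = glue X fᴾ g

    f-inside : ∀ {i v} (v∈Xi : v ∈ X i) → f v ≡ proj₁ (g i (v , v∈Xi))
    f-inside = glue-inside X fᴾ g child-unique

    f-outside : ∀ {v} → v ∉ P → f v ≡ v
    f-outside v∉P = glue-outside X fᴾ g (λ _ → v∉P ∘ child-⊆)

    f-child : ∀ {i v} → v ∈ X i → f v ∈ X (fᴾ i)
    f-child {i} v∈Xi = subst (_∈ X (fᴾ i)) (sym (f-inside v∈Xi)) (proj₂ (g i (_ , v∈Xi)))

    f-P : ∀ {v} → v ∈ P → f v ∈ P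
    f-P v∈P = child-⊆ (f-child (proj₂ (child-of v∈P)))

    G-irrefl : ∀ {x} → ¬ G x x
    G-irrefl e = [ (λ a → O.asym a a) , (λ a → O.asym a a) ]′ (O.directed e)

  -- The image of a vertex of `P` stays in `P` and reveals its child, since `fᴾ` is injective;
  -- inside one child `g i` is injective.
  f-injective : Injective _≡_ _≡_ f
  f-injective {v} {w} eq with v ∈? P | w ∈? P
  ... | no v∉P  | no w∉P  = trans (sym (f-outside v∉P)) (trans eq (f-outside w∉P))
  ... | yes v∈P | no w∉P  = contradiction (subst (_∈ P) (trans eq (f-outside w∉P)) (f-P v∈P)) w∉P
  ... | no v∉P  | yes w∈P =
    contradiction (subst (_∈ P) (trans (sym eq) (f-outside v∉P)) (f-P w∈P)) v∉P
  ... | yes v∈P | yes w∈P with child-of v∈P | child-of w∈P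
  ...   | i , v∈Xi | j , w∈Xj
    with refl ← Fᴾ.injective (child-unique (f-child v∈Xi)
                  (subst (_∈ X (fᴾ j)) (sym eq) (f-child w∈Xj))) =
    cong proj₁ (g.injective i
      (vertices-≡ (trans (sym (f-inside v∈Xi)) (trans eq (f-inside w∈Xj)))))

  private
    -- If the quotient arc runs from `j` to `i`, uniqueness is applied to the reverse of `Fᴾ`. The
    -- maps `to`, `to′` stay abstract to serve both along `fᴾ` and back.
    transfer : ∀ {v w v′ w′ i j i′ j′} → v ∈ X i → w ∈ X j → v′ ∈ X i′ → w′ ∈ X j′ →
      i ≢ j → (Fᴾ i j → Fᴾ i′ j′) → (Fᴾ j i → Fᴾ j′ i′) → F v w → F v′ w′
    transfer v∈ w∈ v′∈ w′∈ i≢j to to′ a =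
      [ (λ i→j → orientation-unique G-irrefl o oᴾ v∈ w∈ v′∈ w′∈ i→j (to i→j) a)
      , (λ j→i → orientation-unique G-irrefl o (flip-orientation quotient-sym oᴾ)
                   v∈ w∈ v′∈ w′∈ j→i (to′ j→i) a) ]′
      (Oᴾ.directed (quotient-edge⁺ i≢j v∈ w∈ (O.arcs⇒edges a)))

    leaving : ∀ {w x y} → w ∉ P → x ∈ P → y ∈ P → F x w → F y w
    leaving = module-uniform-arcs G-sym o P-isModule (IsPrimeNode.coconnected prime)

    entering : ∀ {w x y} → w ∉ P → x ∈ P → y ∈ P → F w x → F w y
    entering = module-uniform-arcs G-sym (flip-orientation G-sym o) P-isModule
      (IsPrimeNode.coconnected prime)

  f-arc⇔ : ∀ v w → F v w ⇔ F (f v) (f w)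
  f-arc⇔ v w with v ∈? P | w ∈? P
  ... | no v∉P  | no w∉P  rewrite f-outside v∉P | f-outside w∉P = mk⇔ id id
  ... | yes v∈P | no w∉P  rewrite f-outside w∉P =
    mk⇔ (leaving w∉P v∈P (f-P v∈P)) (leaving w∉P (f-P v∈P) v∈P)
  ... | no v∉P  | yes w∈P rewrite f-outside v∉P =
    mk⇔ (entering v∉P w∈P (f-P w∈P)) (entering v∉P (f-P w∈P) w∈P)
  ... | yes v∈P | yes w∈P with child-of v∈P | child-of w∈P
  ...   | i , v∈Xi | j , w∈Xj with i ≟ j
  ...     | yes refl rewrite f-inside v∈Xi | f-inside w∈Xj = mk⇔ (g.mono i) (g.cancel i)
  ...     | no  i≢j = mk⇔
    (transfer v∈Xi w∈Xj (f-child v∈Xi) (f-child w∈Xj) i≢j Fᴾ.mono Fᴾ.mono)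
    (transfer (f-child v∈Xi) (f-child w∈Xj) v∈Xi w∈Xj (i≢j ∘ Fᴾ.injective)
              Fᴾ.cancel Fᴾ.cancel)

  f-iso : IsDigraphIso F F f
  f-iso = digraphIso f-injective (injective⇒strictlySurjective f-injective)
    (Equivalence.to (f-arc⇔ _ _)) (Equivalence.from (f-arc⇔ _ _))

-- Transport of `F₁` along the automorphism

theorem6 : ∀ {n : ℕ} (F : Rel (Fin n) 0ℓ) → IsPermutationDigraph F →
    let G  = SymClosure F
        Gᶜ = Complement G
    in
    ∀ (P : Subset n) → IsPrimeNode G P →
    ∀ {p : ℕ} (X : Fin p → Subset n) → EnumeratesChildren G P X →
    ∀ (Fᴾ : Rel (Fin p) 0ℓ) → IsTransitiveOrientation (Quotient G X) Fᴾ →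
    ∀ (F₁ᴾ : Rel (Fin p) 0ℓ) → IsTransitiveOrientation (Quotient Gᶜ X) F₁ᴾ →
    ∀ (fᴾ : Fin p → Fin p) →
    IsDigraphIso Fᴾ Fᴾ fᴾ →
    IsDigraphIso F₁ᴾ (flip F₁ᴾ) fᴾ →
    ∀ (g : ∀ i → Vertices (X i) → Vertices (X (fᴾ i))) →
    (∀ i → IsDigraphIso (F ∣ᵢ X i) (F ∣ᵢ X (fᴾ i)) (g i)) →
    let f = glue X fᴾ g
    in
    ∀ (F₁ : Rel (Fin n) 0ℓ) → IsTransitiveOrientation Gᶜ F₁ →
    ∀ (F₂ : Rel (Fin n) 0ℓ) → (∀ v w → F₂ (f v) (f w) ⇔ F₁ v w) →
    IsTransitiveOrientation Gᶜ F₂ ×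
    (∃ λ (π : Permutation′ n) → Induces F F₁ π × Induces F F₂ π)
theorem6 {n} F perm P prime X children Fᴾ oᴾ _ _ fᴾ fᴾ-iso _ g g-iso F₁ o₁ F₂ F₂⇔F₁ =
  orientation-transport h (complement-⇔ h-injective G⇔) F₁⇔F₂ o₁ ,
  π , induced , induces-transport f.to∘from f.from∘to F⇔ F₁⇔F₂ π induced
  where
  open PermutationDigraph perm

  G = SymClosure F
  G? = symClosure? _F?_
  o  = symClosure-orientation {F = F} F-asym F-trans

  module f = DigraphIso
    (GluedAutomorphism.f-iso G? (symmetric F) o prime children oᴾ fᴾ-iso g g-iso)

  h : Fin n → Fin n
  h = f.from

  h-injective : Injective _≡_ _≡_ h
  h-injective eq = trans (sym (f.to∘from _)) (trans (cong (glue X fᴾ g) eq) (f.to∘from _))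

  F⇔ : ∀ v w → F (h v) (h w) ⇔ F v w
  F⇔ v w = mk⇔ (subst₂ F (f.to∘from v) (f.to∘from w) ∘ f.mono)
               (f.cancel ∘ subst₂ F (sym (f.to∘from v)) (sym (f.to∘from w)))

  G⇔ : ∀ v w → G (h v) (h w) ⇔ G v w
  G⇔ v w = mk⇔
    (λ { (fwd a) → fwd (to (F⇔ v w) a)   ; (bwd a) → bwd (to (F⇔ w v) a) })
    (λ { (fwd a) → fwd (from (F⇔ v w) a) ; (bwd a) → bwd (from (F⇔ w v) a) })
    where open Equivalence

  -- The hypothesis describes `F₂` at images under the glued map only; evaluated at `h v`, `h w` it
  -- reaches every pair.
  F₁⇔F₂ : ∀ v w → F₁ (h v) (h w) ⇔ F₂ v w
  F₁⇔F₂ v w = subst₂ (λ x y → F₁ (h v) (h w) ⇔ F₂ x y) (f.to∘from v) (f.to∘from w)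
    (⇔-sym (F₂⇔F₁ (h v) (h w)))

  π       = proj₁ (inducedPermutation G? (symmetric F) o o₁)
  induced = proj₂ (inducedPermutation G? (symmetric F) o o₁)
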